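{- Let $\mathrm{S}=(P,T,F,M_0)$ be a place/transition net. If $\mathrm{S}$ is e/l-persistent, then there exists $\mathrm{k}\in\mathbb{N}$ such that $\mathrm{S}$ is e/l-$\mathrm{k}$-persistent.
   Context: A place/transition net (p/t-net) is $\mathrm{S}=(P,T,F,M_0)$ where $P$ (places) and $T$ (transitions) are finite disjoint sets, $F\subseteq P\times T\cup T\times P$ is the flow relation, and $M_0\in\mathbb{N}^P$ is the initial marking. Markings are vectors in $\mathbb{N}^P$, ordered and added componentwise. For $a\in T$, ${}^\bullet a\in\mathbb{N}^P$ is the vector with $1$ at places $p$ with $(p,a)\in F$ and $0$ elsewhere; $a^\bullet$ is the vector with $1$ at places $p$ with $(a,p)\in F$ and $0$ elsewhere. A transition $a$ is enabled in $M$ (written $Ma$) iff ${}^\bullet a\le M$; then firing $a$ yields $M'=(M-{}^\bullet a)+a^\bullet$ (written $MaM'$). This is extended to strings $w\in T^*$: $M\varepsilon M$, and $MvaM''$ iff $MvM'$ and $M'aM''$ for some $M'$; $Mw$ means $MwM'$ for some $M'$. The set $[M_0\rangle$ of reachable markings consists of all $M'$ with $M_0wM'$ for some $w\in T^*$. The net is e/l-persistent iff for all $M\in[M_0\rangle$ and all $a,b\in T$ with $a\ne b$: $Ma\wedge Mb\Rightarrow \exists v\in T^*\ Mavb$. For $\mathrm{k}\in\mathbb{N}$, a step $Ma$ (with $a$ enabled in $M$) is e/l-$\mathrm{k}$-persistent iff for every $b\in T$, $b\neq a$, $Mb$ implies that there exists $w\in T^*$ with $|w|\le\mathrm{k}$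 and $Mawb$. A marking $M$ is e/l-$\mathrm{k}$-persistent iff for every $a\in T$ enabled in $M$ the step $Ma$ is e/l-$\mathrm{k}$-persistent; the net is e/l-$\mathrm{k}$-persistent iff every marking in $[M_0\rangle$ is e/l-$\mathrm{k}$-persistent. -}

module Defs where

open import Data.Nat using (ℕ; _≤_; _+_; _∸_)
open import Data.Fin using (Fin)
open import Data.Bool using (Bool; true; false)
open import Data.List using (List; []; _∷_; length)
open import Data.Product using (Σ; _×_; _,_; ∃)
open import Relation.Binary.PropositionalEquality using (_≡_; _≢_)

-- A place/transition net S = (P, T, F, M0) with finite P = Fin np, T = Fin nt.
-- The flow relation F ⊆ P×T ∪ T×P is given by its two (Boolean) components:
--   inF  a p = true  iff (p , a) ∈ F
--   outF a p = true  iff (a , p) ∈ F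
record PTNet : Set where
  field
    np   : ℕ
    nt   : ℕ
    inF  : Fin nt → Fin np → Bool
    outF : Fin nt → Fin np → Bool
    M₀   : Fin np → ℕ

module _ (S : PTNet) where
  open PTNet S

  Place : Set
  Place = Fin np

  Trans : Set
  Trans = Fin nt

  Marking : Set
  Marking = Place → ℕ

  b2n : Bool → ℕ
  b2n true  = 1
  b2n false = 0

  pre : Trans → Marking
  pre a p = b2n (inF a p)

  post : Trans → Marking
  post a p = b2n (outF a p)

  Enabled : Marking → Trans → Set
  Enabled M a = ∀ p → pre a p ≤ M p

  Fires : Marking → Trans → Marking → Set
  Fires M a M' = Enabled M a × (∀ p → M' p ≡ (M p ∸ pre a p) + post a p)

  data FiresSeq : Marking → List Trans → Marking → Set where
    ε-fire : ∀ {M} → FiresSeq M [] M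
    step   : ∀ {M M' M'' a w} → Fires M a M' → FiresSeq M' w M'' → FiresSeq M (a ∷ w) M''

  Firable : Marking → List Trans → Set
  Firable M w = Σ Marking λ M' → FiresSeq M w M'

  Reachable : Marking → Set
  Reachable M = Σ (List Trans) λ w → FiresSeq M₀ w M

  ELPersistent : Set
  ELPersistent = ∀ M → Reachable M → ∀ (a b : Trans) → a ≢ b →
    Enabled M a → Enabled M b →
    Σ (List Trans) λ v → Σ Marking λ M' → Fires M a M' × Firable M' (v Data.List.++ (b ∷ []))

  ELkPersistentStep : ℕ → Marking → Trans → Set
  ELkPersistentStep k M a = ∀ (b : Trans) → b ≢ a → Enabled M b →
    Σ (List Trans) λ w → length w ≤ k ×
      (Σ Marking λ M' → Fires M a M' × Firable M' (w Data.List.++ (b ∷ [])))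

  ELkPersistentMarking : ℕ → Marking → Set
  ELkPersistentMarking k M = ∀ a → Enabled M a → ELkPersistentStep k M a

  ELkPersistent : ℕ → Set
  ELkPersistent k = ∀ M → Reachable M → ELkPersistentMarking k M

{-# OPTIONS --safe #-}

-- For a fixed transition b, the markings from which b can be reached by firing at most k further
-- transitions form an upward closed set, generated by a finite list computed by backward
-- coverability. These sets increase with k, so by Dickson's lemma they become stationary at some
-- k_b: whenever b can be reached at all, it can be reached after at most k_b firings. Persistence
-- supplies the reachability, and k is the maximum of the k_b. Constructively, Dickson's lemma is
-- the statement that the pointwise order on ℕⁿ is almost full, which follows from the
-- intuitionistic Ramsey theorem of Vytiniotis, Coquand and Wahlstedt.
module Submission where

open import Defs
open import Data.Empty using (⊥-elim)
open import Data.Nat using (ℕ; zero; suc; _+_; _∸_; _≤_; z≤n; s≤s)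
open import Data.Nat.Properties
open import Data.Fin using (Fin; zero; suc)
open import Data.Fin.Properties using (all?)
open import Data.List using (List; []; _∷_; _++_; length; tabulate; allFin; cartesianProductWith)
open import Data.List.Extrema.Nat using (max; xs≤max)
open import Data.List.Membership.Propositional using (find; lose)
open import Data.List.Membership.Propositional.Properties
  using (∈-allFin; ∈-cartesianProductWith⁺; ∈-cartesianProductWith⁻)
open import Data.List.Relation.Unary.Any as Any using (Any; here)
open import Data.List.Relation.Unary.Any.Properties using (++⁺ˡ; ++⁺ʳ; ++⁻)
import Data.List.Relation.Unary.All as All
import Data.List.Relation.Unary.All.Properties as All
open import Data.Product using (Σ; ∃; _×_; _,_; proj₁; proj₂)
open import Data.Sum using (_⊎_; inj₁; inj₂; [_,_]; map₁; map₂)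
open import Function using (_∘_)
open import Relation.Binary.PropositionalEquality using (refl; sym; subst)
open import Relation.Nullary using (¬_; yes; no)
open import Relation.Nullary.Decidable using (Dec)

-- Almost-full relations and Ramsey's theorem

-- A well-founded tree stands in for the quantifier over infinite sequences: reading `x` relaxes the
-- relation by `R x y`, and proofs recurse on the tree.
data AlmostFull {X : Set} (R : X → X → Set) : Set₁ where
  now   : (∀ x y → R x y) → AlmostFull R
  later : (∀ x → AlmostFull (λ y z → R y z ⊎ R x y)) → AlmostFull R

module _ {X : Set} where

  af-mono : {R S : X → X → Set} → (∀ {x y} → R x y → S x y) → AlmostFull R → AlmostFull S
  af-mono R⊆S (now r)   = now λ x y → R⊆S (r x y)
  af-mono R⊆S (later f) = later λ x →
    af-mono [ inj₁ ∘ R⊆S , inj₂ ∘ R⊆S ] (f x)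

  af-on : {Y : Set} {R : Y → Y → Set} (f : X → Y) →
          AlmostFull R → AlmostFull (λ x y → R (f x) (f y))
  af-on f (now r)   = now λ x y → r (f x) (f y)
  af-on f (later g) = later λ x → af-on f (g (f x))

  -- As `A` and `B` mention no element, recursion on the first tree is enough: at its leaf every
  -- pair gives `C` or `A`, and `S` supplies `C` or `B`.
  af-∩-nullary : {R S C : X → X → Set} {A B : Set} →
    AlmostFull R → (∀ {x y} → R x y → C x y ⊎ A) →
    AlmostFull S → (∀ {x y} → S x y → C x y ⊎ B) →
    AlmostFull (λ x y → C x y ⊎ A × B)
  af-∩-nullary (now r) R⊆ s S⊆ =
    af-mono (λ {x} {y} Sxy →
      [ inj₁ , (λ b → [ inj₁ , (λ a → inj₂ (a , b)) ] (R⊆ (r x y))) ] (S⊆ Sxy)) s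
  af-∩-nullary {C = C} (later f) R⊆ s S⊆ = later λ x →
    af-mono
      (λ { (inj₁ (inj₁ c)) → inj₁ (inj₁ c)
         ; (inj₁ (inj₂ c)) → inj₂ (inj₁ c)
         ; (inj₂ ab)       → inj₁ (inj₂ ab) })
      (af-∩-nullary {C = λ y z → C y z ⊎ C x y}
        (f x) [ map₁ inj₁ ∘ R⊆ , map₁ inj₂ ∘ R⊆ ]
        s (map₁ inj₁ ∘ S⊆))

  af-∩-unary : {R S C : X → X → Set} {A B : X → Set} →
    AlmostFull R → (∀ {x y} → R x y → C x y ⊎ A x) →
    AlmostFull S → (∀ {x y} → S x y → C x y ⊎ B x) →
    AlmostFull (λ x y → C x y ⊎ A x × B x)
  af-∩-unary (now r) R⊆ s S⊆ =
    af-mono (λ {x} {y} Sxy →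
      [ inj₁ , (λ b → [ inj₁ , (λ a → inj₂ (a , b)) ] (R⊆ (r x y))) ] (S⊆ Sxy)) s
  af-∩-unary r@(later _) R⊆ (now s) S⊆ =
    af-mono (λ {x} {y} Rxy →
      [ inj₁ , (λ a → [ inj₁ , (λ b → inj₂ (a , b)) ] (S⊆ (s x y))) ] (R⊆ Rxy)) r
  af-∩-unary {C = C} {A} {B} r@(later f) R⊆ s@(later g) S⊆ = later λ x →
    af-mono
      (λ { (inj₁ (inj₁ (inj₁ c))) → inj₁ (inj₁ c)
         ; (inj₁ (inj₁ (inj₂ c))) → inj₂ (inj₁ c)
         ; (inj₁ (inj₂ ab))       → inj₁ (inj₂ ab)
         ; (inj₂ ab)              → inj₂ (inj₂ ab) })
      -- Descending in one tree at a time leaves the excess `A x` in one result and `B x` in the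
      -- other. With `x` fixed, both are nullary on the first of the remaining elements only through
      -- `x y`-independent choice of index, so they are joined as constants.
      (af-∩-nullary {C = λ y z → (C y z ⊎ C x y) ⊎ A y × B y} {A = A x} {B = B x}
        (af-∩-unary {C = λ y z → (C y z ⊎ C x y) ⊎ A x}
          (f x) [ map₁ (inj₁ ∘ inj₁) ∘ R⊆ , [ inj₁ ∘ inj₁ ∘ inj₂ , inj₁ ∘ inj₂ ] ∘ R⊆ ]
          s (map₁ (inj₁ ∘ inj₁) ∘ S⊆))
        swapʳ
        (af-∩-unary {C = λ y z → (C y z ⊎ C x y) ⊎ B x}
          r (map₁ (inj₁ ∘ inj₁) ∘ R⊆)
          (g x) [ map₁ (inj₁ ∘ inj₁) ∘ S⊆ , [ inj₁ ∘ inj₁ ∘ inj₂ , inj₁ ∘ inj₂ ] ∘ S⊆ ])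
        swapʳ)
    where
    swapʳ : {P Q T : Set} → (P ⊎ Q) ⊎ T → (P ⊎ T) ⊎ Q
    swapʳ = [ map₁ inj₁ , inj₁ ∘ inj₂ ]

  -- Reading `x` relaxes one factor at a time. The excess is the unary predicate `R x` or `S x`, and
  -- the unary case recombines the two.
  af-∩ : {R S : X → X → Set} →
    AlmostFull R → AlmostFull S → AlmostFull (λ x y → R x y × S x y)
  af-∩ (now r) s           = af-mono (λ Sxy → r _ _ , Sxy) s
  af-∩ r@(later _) (now s) = af-mono (λ Rxy → Rxy , s _ _) r
  af-∩ {R} {S} r@(later f) s@(later g) = later λ x →
    af-∩-unary {C = λ y z → R y z × S y z} {A = R x} {B = S x}
      (af-∩ (f x) s) (λ { (inj₁ r , s) → inj₁ (r , s) ; (inj₂ r , _) → inj₂ r })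
      (af-∩ r (g x)) (λ { (r , inj₁ s) → inj₁ (r , s) ; (_ , inj₂ s) → inj₂ s })

  af-⋂ : ∀ n {R : Fin n → X → X → Set} →
    (∀ i → AlmostFull (R i)) → AlmostFull (λ x y → ∀ i → R i x y)
  af-⋂ zero    _ = now λ _ _ ()
  af-⋂ (suc n) r =
    af-mono (λ { (p , q) zero → p ; (p , q) (suc i) → q i })
      (af-∩ (r zero) (af-⋂ n (r ∘ suc)))

  -- The almost-fullness tree is descended along elements that are new at each stage. At a leaf the
  -- new element lies below everything, so the next stage is the whole type.
  af⇒chain-stabilises : {R : X → X → Set} (U : ℕ → X → Set) → AlmostFull R →
    (∀ k {x y} → R x y → U k x → U k y) →
    (∀ k {x} → U k x → U (suc k) x) →
    (∀ k → (∀ {x} → U (suc k) x → U k x) ⊎ (∃ λ x → U (suc k) x × ¬ U k x)) →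
    ∃ λ k → ∀ {x} → U (suc k) x → U k x
  af⇒chain-stabilises {R} U af upward increasing stable? = descend af 0 inj₁
    where
    -- Invariant: whatever the elements read so far have added to `R` holds only for `x` already in
    -- stage `k`.
    descend : ∀ {R′} → AlmostFull R′ → ∀ k → (∀ {x y} → R′ x y → R x y ⊎ U k x) →
              ∃ λ k → ∀ {x} → U (suc k) x → U k x
    descend af k R′⊆ with stable? k
    descend af        k R′⊆ | inj₁ stable         = k , stable
    descend (now r)   k R′⊆ | inj₂ (x , x∈ , x∉) =
      suc k , λ _ → [ (λ Rxy → upward (suc k) Rxy x∈) , ⊥-elim ∘ x∉ ] (R′⊆ (r x _))
    descend (later f) k R′⊆ | inj₂ (x , x∈ , x∉) =
      descend (f x) (suc k)
        [ map₂ (increasing k) ∘ R′⊆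
        , (λ R′xy → inj₂ ([ (λ Rxy → upward (suc k) Rxy x∈) , ⊥-elim ∘ x∉ ] (R′⊆ R′xy))) ]

-- Once `n` has been read, only elements below `n` are still constrained, which leaves an induction
-- on `n`.
af-≤ : AlmostFull _≤_
af-≤ = later bounded
  where
  bounded : ∀ n → AlmostFull (λ x y → x ≤ y ⊎ n ≤ x)
  bounded zero    = now λ _ _ → inj₂ z≤n
  bounded (suc n) = later split
    where
    split : ∀ m → AlmostFull (λ x y → (x ≤ y ⊎ suc n ≤ x) ⊎ (m ≤ x ⊎ suc n ≤ m))
    split m with suc n ≤? m
    ... | yes n<m = now λ _ _ → inj₂ (inj₂ n<m)
    ... | no  n≮m =
      af-mono [ inj₁ ∘ inj₁ , (λ n≤x → inj₂ (inj₁ (≤-trans (≮⇒≥ n≮m) n≤x))) ] (bounded n)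

-- Markings and weakest preconditions

module _ (S : PTNet) where
  open PTNet S using (np; nt)

  infix 4 _≤ᴹ_

  _≤ᴹ_ : Marking S → Marking S → Set
  M ≤ᴹ N = ∀ p → M p ≤ N p

  ≤ᴹ-trans : ∀ {L M N} → L ≤ᴹ M → M ≤ᴹ N → L ≤ᴹ N
  ≤ᴹ-trans L≤M M≤N p = ≤-trans (L≤M p) (M≤N p)

  _≤ᴹ?_ : ∀ M N → Dec (M ≤ᴹ N)
  M ≤ᴹ? N = all? λ p → M p ≤? N p

  dickson : AlmostFull _≤ᴹ_
  dickson = af-⋂ np λ p → af-on (λ M → M p) af-≤

  fire : Trans S → Marking S → Marking S
  fire t M p = (M p ∸ pre S t p) + post S t p

  -- Truncated subtraction makes the demand at a place zero, apart from `pre`, when `t` produces at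
  -- least what `m` asks there.
  weakestPre : Trans S → Marking S → Marking S
  weakestPre t m p = pre S t p + (m p ∸ post S t p)

  weakestPre-enabled : ∀ {t m M} → weakestPre t m ≤ᴹ M → Enabled S M t
  weakestPre-enabled le p = m+n≤o⇒m≤o _ (le p)

  weakestPre-fire : ∀ {t m M} → weakestPre t m ≤ᴹ M → m ≤ᴹ fire t M
  weakestPre-fire {t} {m} {M} le p = begin
    m p                                    ≤⟨ m≤n+m∸n (m p) (post S t p) ⟩
    post S t p + (m p ∸ post S t p)        ≤⟨ +-monoʳ-≤ (post S t p) (m+n≤o⇒m≤o∸n _ le′) ⟩
    post S t p + (M p ∸ pre S t p)         ≡⟨ +-comm (post S t p) _ ⟩
    fire t M p                             ∎
    where
    open ≤-Reasoning
    le′ : (m p ∸ post S t p) + pre S t p ≤ M p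
    le′ = subst (_≤ M p) (+-comm (pre S t p) _) (le p)

  weakestPre-least : ∀ {t m M M′} → Fires S M t M′ → m ≤ᴹ M′ → weakestPre t m ≤ᴹ M
  weakestPre-least {t} {m} {M} {M′} (enabled , M′≡) m≤M′ p = begin
    pre S t p + (m p ∸ post S t p)  ≤⟨ +-monoʳ-≤ (pre S t p) (m≤n+o⇒m∸n≤o (m p) (post S t p) le) ⟩
    pre S t p + (M p ∸ pre S t p)   ≡⟨ m+[n∸m]≡n (enabled p) ⟩
    M p                             ∎
    where
    open ≤-Reasoning
    le : m p ≤ post S t p + (M p ∸ pre S t p)
    le = begin
      m p                             ≤⟨ m≤M′ p ⟩
      M′ p                            ≡⟨ M′≡ p ⟩
      (M p ∸ pre S t p) + post S t p  ≡⟨ +-comm _ (post S t p) ⟩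
      post S t p + (M p ∸ pre S t p)  ∎

  -- Backward coverability

  module _ (b : Trans S) where

    basis : ℕ → List (Marking S)
    basis zero    = pre S b ∷ []
    -- Keeping `basis k` makes a stage mean at most, not exactly, `k` firings before `b`, so the
    -- stages increase.
    basis (suc k) = basis k ++ cartesianProductWith weakestPre (allFin nt) (basis k)

    Covered : ℕ → Marking S → Set
    Covered k M = Any (_≤ᴹ M) (basis k)

    covered-upward : ∀ k {M N} → M ≤ᴹ N → Covered k M → Covered k N
    covered-upward k M≤N = Any.map λ m≤M → ≤ᴹ-trans m≤M M≤N

    covered-suc : ∀ k {M} → Covered k M → Covered (suc k) M
    covered-suc k = ++⁺ˡ

    covered-pre : ∀ k {t M M′} → Fires S M t M′ → Covered k M′ → Covered (suc k) M
    covered-pre k {t} fires c with find c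
    ... | m , m∈ , m≤M′ =
      ++⁺ʳ (basis k)
        (lose (∈-cartesianProductWith⁺ weakestPre (∈-allFin t) m∈) (weakestPre-least fires m≤M′))

    covered⇒firable : ∀ k {M} → Covered k M →
      ∃ λ w → length w ≤ k × Firable S M (w ++ b ∷ [])
    covered⇒firable zero    {M} (here enabled) =
      [] , z≤n , fire b M , step (enabled , λ _ → refl) ε-fire
    covered⇒firable (suc k) {M} c with ++⁻ (basis k) c
    ... | inj₁ c′ with covered⇒firable k c′
    ...   | w , |w|≤k , firable = w , m≤n⇒m≤1+n |w|≤k , firable
    covered⇒firable (suc k) {M} c | inj₂ c′ with find c′
    ... | _ , m∈ , m≤M with ∈-cartesianProductWith⁻ weakestPre (allFin nt) (basis k) m∈
    ...   | t , m , _ , m∈k , refl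
          with covered⇒firable k (lose m∈k (weakestPre-fire {t} m≤M))
    ...     | w , |w|≤k , M″ , fires =
              t ∷ w , s≤s |w|≤k , M″ , step (weakestPre-enabled m≤M , λ _ → refl) fires

    -- Both stages are upward closed with finite bases, so inclusion is decided on the generators,
    -- and a failing generator is the new element.
    covered-stable? : ∀ k → (∀ {M} → Covered (suc k) M → Covered k M) ⊎
                            (∃ λ M → Covered (suc k) M × ¬ Covered k M)
    covered-stable? k with All.all? (λ M → Any.any? (_≤ᴹ? M) (basis k)) (basis (suc k))
    ... | yes covered = inj₁ λ c → let m , m∈ , m≤M = find c in
                                   covered-upward k m≤M (All.lookup covered m∈)
    ... | no ¬covered with find (All.¬All⇒Any¬ (λ M → Any.any? (_≤ᴹ? M) (basis k)) _ ¬covered)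
    ...   | M , M∈ , M∉ = inj₂ (M , lose M∈ (λ _ → ≤-refl) , M∉)

    covered-stabilises : ∃ λ k → ∀ {M} → Covered (suc k) M → Covered k M
    covered-stabilises =
      af⇒chain-stabilises Covered dickson covered-upward covered-suc covered-stable?

    covered-zero : ∀ k {M} → Enabled S M b → Covered k M
    covered-zero zero    enabled = here enabled
    covered-zero (suc k) enabled = covered-suc k (covered-zero k enabled)

    firingBound : ℕ
    firingBound = proj₁ covered-stabilises

    -- Each transition of `w` raises the stage by one and stationarity lowers it again, so the
    -- length of `w` never enters the bound.
    firable⇒covered : ∀ w {M} → Firable S M (w ++ b ∷ []) → Covered firingBound M
    firable⇒covered []      (_ , step (enabled , _) _) = covered-zero firingBound enabled
    firable⇒covered (t ∷ w) (M″ , step fires rest)     =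
      proj₂ covered-stabilises
        (covered-pre firingBound fires (firable⇒covered w (M″ , rest)))

    firable-within-bound : ∀ {w M} → Firable S M (w ++ b ∷ []) →
      ∃ λ v → length v ≤ firingBound × Firable S M (v ++ b ∷ [])
    firable-within-bound {w} firable = covered⇒firable firingBound (firable⇒covered w firable)

theorem10 : (S : PTNet) → ELPersistent S → Σ ℕ (λ k → ELkPersistent S k)
theorem10 S persistent = k , λ M reachable a Ma b b≢a Mb →
  let v , M′ , fires , firable = persistent M reachable a b (b≢a ∘ sym) Ma Mb
      w , |w|≤kᵇ , firable′    = firable-within-bound S b {v} firable
  in  w , ≤-trans |w|≤kᵇ (firingBound≤k b) , M′ , fires , firable′
  where
  bounds : List ℕ
  bounds = tabulate (firingBound S)

  k : ℕ
  -- The default 0 is the value for a net without transitions.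
  k = max 0 bounds

  firingBound≤k : ∀ b → firingBound S b ≤ k
  firingBound≤k = All.tabulate⁻ (xs≤max 0 bounds)
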